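{- Let $n<\omega$. (i) Every $A\in\mathcal{F}^\nabla_n$ is $\mathrm{RC}^\nabla$-equivalent to a formula in fat normal form. (ii) The words in the fat normal form of $A$ are unique modulo equivalence in $\mathrm{RC}$: if $\nabla_nA_n\land\dots\land\nabla_{n+k}A_{n+k}$ and $\nabla_nB_n\land\dots\land\nabla_{n+m}B_{n+m}$ are both in fat normal form and both $\mathrm{RC}^\nabla$-equivalent to $A$, then $k=m$ and $A_i$ and $B_i$ are equivalent for every $i=n,\dots,n+k$.
   Context: Strictly positive formulas are built from propositional variables and $\top$ by $\land$ and unary modalities $\Diamond_n,\nabla_n$ ($n<\omega$). $\mathcal{F}^\nabla_n$ is the set of variable-free strictly positive formulas using only modalities $\Diamond_i,\nabla_i$ with $i\ge n$. A word is a formula $\Diamond_{j_1}\cdots\Diamond_{j_r}\top$; $\mathcal{W}_i$ is the set of words with all $j_s\ge i$. $\mathrm{RC}^\nabla$ is the smallest set of sequents $A\vdash B$ containing the following axioms and closed under the following rules and under substitution: (1) $A\vdash A$; $A\vdash\top$; $A\land B\vdash A$; $A\land B\vdash B$; from $A\vdash B$, $B\vdash C$ infer $A\vdash C$; from $A\vdash B$, $A\vdash C$ infer $A\vdash B\land C$; from $A\vdash B$ infer $aA\vdash aB$ for each modality $a$; (2) $aaA\vdash aA$ for each modality $a$; (3) for $m<n$: $\Diamond_nA\vdash\Diamond_mA$, $\Diamond_nA\land\Diamond_mB\vdash\Diamond_n(A\land\Diamond_mB)$, and the same two with $\nabla$ in place of $\Diamond$; (4) $A\vdash\nabla_nA$,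 $\Diamond_nA\vdash\nabla_nA$; (5) for $m\le n$: $\Diamond_m\nabla_nA\vdash\Diamond_mA$, $\nabla_n\Diamond_mA\vdash\Diamond_mA$. $\mathrm{RC}$ is the analogous system in the signature $\{\Diamond_n\}$ only (axioms/rules (1)–(3) for $\Diamond$). A formula $A\in\mathcal{F}^\nabla_n$ is in fat normal form if either $A$ is literally $\top$, or $A$ is $\nabla_nA_n\land\nabla_{n+1}A_{n+1}\land\dots\land\nabla_{n+k}A_{n+k}$ where $A_i\in\mathcal{W}_i$ for all $i$, $A_{n+k}$ is not the word $\top$, and for all $i=n,\dots,n+k$, $\nabla_iA_i\vdash\nabla_i(\nabla_iA_i\land\dots\land\nabla_{n+k}A_{n+k})$ is provable in $\mathrm{RC}^\nabla$. -}

module Defs where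

open import Data.Nat using (ℕ; zero; suc; _≤_; _<_)
open import Data.List using (List; []; _∷_)
open import Data.List.Relation.Unary.All using (All)
open import Data.Product using (_×_; Σ; Σ-syntax)
open import Data.Sum using (_⊎_)
open import Data.Unit using () renaming (⊤ to Unit)
open import Relation.Binary.PropositionalEquality using (_≡_; _≢_)

data Mod : Set where
  dia nab : Mod

infixr 6 _∧_

data Fm : Set where
  var : ℕ → Fm
  top : Fm
  _∧_ : Fm → Fm → Fm
  md  : Mod → ℕ → Fm → Fm

◇ : ℕ → Fm → Fm
◇ = md dia

∇ : ℕ → Fm → Fm
∇ = md nab

-- The calculus RC^∇.  Axioms are schemata over arbitrary formulas, so
-- the set of derivable sequents is closed under substitution.

infix 4 _⊢_

data _⊢_ : Fm → Fm → Set where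
  refl⊢  : ∀ {A} → A ⊢ A
  top⊢   : ∀ {A} → A ⊢ top
  ∧-e₁   : ∀ {A B} → A ∧ B ⊢ A
  ∧-e₂   : ∀ {A B} → A ∧ B ⊢ B
  cut    : ∀ {A B C} → A ⊢ B → B ⊢ C → A ⊢ C
  ∧-i    : ∀ {A B C} → A ⊢ B → A ⊢ C → A ⊢ B ∧ C
  mono   : ∀ {a n A B} → A ⊢ B → md a n A ⊢ md a n B
  trans4 : ∀ {a n A} → md a n (md a n A) ⊢ md a n A
  down   : ∀ {a m n A} → m < n → md a n A ⊢ md a m A
  mix    : ∀ {a m n A B} → m < n →
           md a n A ∧ md a m B ⊢ md a n (A ∧ md a m B)
  refl∇  : ∀ {n A} → A ⊢ ∇ n A
  ◇∇     : ∀ {n A} → ◇ n A ⊢ ∇ n A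
  ◇∇◇    : ∀ {m n A} → m ≤ n → ◇ m (∇ n A) ⊢ ◇ m A
  ∇◇◇    : ∀ {m n A} → m ≤ n → ∇ n (◇ m A) ⊢ ◇ m A

_≡⊢_ : Fm → Fm → Set
A ≡⊢ B = (A ⊢ B) × (B ⊢ A)

data RFm : Set where
  var : ℕ → RFm
  top : RFm
  _∧_ : RFm → RFm → RFm
  ◇ᴿ  : ℕ → RFm → RFm

infix 4 _⊢ᴿ_

data _⊢ᴿ_ : RFm → RFm → Set where
  refl⊢  : ∀ {A} → A ⊢ᴿ A
  top⊢   : ∀ {A} → A ⊢ᴿ top
  ∧-e₁   : ∀ {A B} → A ∧ B ⊢ᴿ A
  ∧-e₂   : ∀ {A B} → A ∧ B ⊢ᴿ B
  cut    : ∀ {A B C} → A ⊢ᴿ B → B ⊢ᴿ C → A ⊢ᴿ C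
  ∧-i    : ∀ {A B C} → A ⊢ᴿ B → A ⊢ᴿ C → A ⊢ᴿ B ∧ C
  mono   : ∀ {n A B} → A ⊢ᴿ B → ◇ᴿ n A ⊢ᴿ ◇ᴿ n B
  trans4 : ∀ {n A} → ◇ᴿ n (◇ᴿ n A) ⊢ᴿ ◇ᴿ n A
  down   : ∀ {m n A} → m < n → ◇ᴿ n A ⊢ᴿ ◇ᴿ m A
  mix    : ∀ {m n A B} → m < n →
           ◇ᴿ n A ∧ ◇ᴿ m B ⊢ᴿ ◇ᴿ n (A ∧ ◇ᴿ m B)

_≡⊢ᴿ_ : RFm → RFm → Set
A ≡⊢ᴿ B = (A ⊢ᴿ B) × (B ⊢ᴿ A)

Word : Set
Word = List ℕ

⟦_⟧ : Word → Fm
⟦ [] ⟧     = top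
⟦ j ∷ js ⟧ = ◇ j ⟦ js ⟧

⟦_⟧ᴿ : Word → RFm
⟦ [] ⟧ᴿ     = top
⟦ j ∷ js ⟧ᴿ = ◇ᴿ j ⟦ js ⟧ᴿ

InW : ℕ → Word → Set
InW i w = All (i ≤_) w

data InF (n : ℕ) : Fm → Set where
  top : InF n top
  _∧_ : ∀ {A B} → InF n A → InF n B → InF n (A ∧ B)
  md  : ∀ {a i A} → n ≤ i → InF n A → InF n (md a i A)

conj : ℕ → Word → List Word → Fm
conj n w []       = ∇ n ⟦ w ⟧
conj n w (v ∷ vs) = ∇ n ⟦ w ⟧ ∧ conj (suc n) v vs

FatCond : ℕ → Word → List Word → Set
FatCond n w []       = InW n w × (w ≢ []) × (∇ n ⟦ w ⟧ ⊢ ∇ n (conj n w []))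
FatCond n w (v ∷ vs) = InW n w × (∇ n ⟦ w ⟧ ⊢ ∇ n (conj n w (v ∷ vs)))
                       × FatCond (suc n) v vs

IsFNF : ℕ → Fm → Set
IsFNF n B = (B ≡ top) ⊎ (Σ[ w ∈ Word ] Σ[ ws ∈ List Word ] (B ≡ conj n w ws) × FatCond n w ws)

_≡⊢ᴿ'_ : Word → Word → Set
u ≡⊢ᴿ' v = ⟦ u ⟧ᴿ ≡⊢ᴿ ⟦ v ⟧ᴿ

{-# OPTIONS --safe #-}
-- Existence: words in W_n are linearly ordered by u ⊢ ◇_n v up to equivalence, so they are
-- closed under conjunction, and ∇_n (∇_n w ∧ v) with w in W_n, v in W_{n+1} is always of the
-- form ∇_n w′.  This lets a conjunct ∇_n w be put in front of a fat normal form at n + 1,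
-- and closure of fat normal forms under the connectives follows.
--
-- Uniqueness: applying ∇_n to equivalent normal forms isolates the heads, and these are
-- compared by linearity, where the strict cases would give w ⊢ ◇_n w.  Erasing the
-- modalities of index ≤ n preserves derivability, which isolates the tails.
--
-- Irreflexivity w ⊬ ◇_n w comes from a model in the style of Ignatiev's: points are
-- sequences x of ordinal notations with x (i + 1) at most every exponent of x i, and ◇_n
-- and ∇_n refer to the points y with y i ≺ x i, respectively y i ≼ x i, for all i ≤ n.
-- Words have least points, and truth is upward closed.
module Submission where

open import Defs
open import Data.Nat using (ℕ; zero; suc; _≤_; _<_; _+_; z≤n; s≤s; _≤?_)
open import Data.Nat.Properties
  using (≤-refl; ≤-trans; <⇒≤; n≤1+n; m≤m+n; m≤n+m; m<n⇒m<1+n; <-≤-trans; <⇒≱; +-suc;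
         m∸n+n≡m; m≤n⇒m<n∨m≡n)
open import Data.List using (List; []; _∷_; _++_; length)
open import Data.List.Relation.Unary.All as All using ([]; _∷_)
open import Data.List.Relation.Unary.All.Properties using (++⁺)
open import Data.List.Relation.Binary.Pointwise using (Pointwise; []; _∷_; Pointwise-length)
open import Data.Product using (_×_; _,_; proj₁; proj₂; Σ-syntax; swap)
open import Data.Sum using (_⊎_; inj₁; inj₂)
open import Data.Unit using () renaming (⊤ to Unit)
open import Data.Empty using (⊥-elim)
open import Function using (_∘_; const; id)
open import Relation.Nullary using (¬_; Dec; yes; no)
open import Relation.Binary using
  (Transitive; Trichotomous; tri<; tri≈; tri>; StrictTotalOrder; DecTotalOrder)
open import Relation.Binary.Structures.Biased using (isStrictTotalOrderᶜ)
open import Relation.Binary.PropositionalEquality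
  using (_≡_; _≢_; refl; sym; trans; cong; cong₂; subst; subst₂; isEquivalence)
import Relation.Binary.Properties.StrictTotalOrder as StrictTotalOrderProperties
import Algebra.Construct.NaturalChoice.Max as Max

infixr 5 _⨾ᴿ_ _⨾_

_⨾ᴿ_ : ∀ {A B C} → A ⊢ᴿ B → B ⊢ᴿ C → A ⊢ᴿ C
_⨾ᴿ_ = cut

_⨾_ : ∀ {A B C} → A ⊢ B → B ⊢ C → A ⊢ C
_⨾_ = cut

-- Words in RC

-- Splitting u ∈ W_n at its first letter n, recursively in both parts, makes the comparison
-- of words a structural recursion, although one part moves up to W_{n+1}.
data View (n : ℕ) : Word → Set
data Tail (n : ℕ) : Word → Set

data View n where
  empty : View n []
  _⧺_   : ∀ {e t} → View (suc n) e → Tail n t → View n (e ++ t)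

data Tail n where
  []  : Tail n []
  at∷ : ∀ {f} → View n f → Tail n (n ∷ f)

InW-pred : ∀ {n u} → InW (suc n) u → InW n u
InW-pred = All.map (≤-trans (n≤1+n _))

view⇒InW : ∀ {n u} → View n u → InW n u
tail⇒InW : ∀ {n t} → Tail n t → InW n t

view⇒InW empty = []
view⇒InW (e ⧺ t) = ++⁺ (InW-pred (view⇒InW e)) (tail⇒InW t)

tail⇒InW [] = []
tail⇒InW (at∷ f) = ≤-refl ∷ view⇒InW f

-- Induction on the distance from `n` to `j`: a letter above `n` joins the upper part, one level
-- higher, and the letter `n` opens a new tail.
view-∷ : ∀ k {n j u} → k + n ≡ j → View n u → View n (j ∷ u)
view-∷ zero refl f = empty ⧺ at∷ f
view-∷ (suc k) eq empty = view-∷ k (trans (+-suc k _) eq) empty ⧺ []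
view-∷ (suc k) eq (e ⧺ t) = view-∷ k (trans (+-suc k _) eq) e ⧺ t

view : ∀ {n u} → InW n u → View n u
view [] = empty
view (n≤j ∷ p) = view-∷ _ (m∸n+n≡m n≤j) (view p)

◇ᴿ-tail : ∀ {n j t} → n < j → Tail n t → ◇ᴿ j ⟦ t ⟧ᴿ ⊢ᴿ ⟦ t ⟧ᴿ
◇ᴿ-tail n<j [] = top⊢
◇ᴿ-tail n<j (at∷ _) = down n<j ⨾ᴿ trans4

-- A tail is empty or starts with `n`, so a larger diamond in front of it weakens to index `n` and
-- merges. In the converse below, `mix` carries the tail inward.
++⇒∧ : ∀ {n e t} → InW (suc n) e → Tail n t → ⟦ e ++ t ⟧ᴿ ⊢ᴿ ⟦ e ⟧ᴿ ∧ ⟦ t ⟧ᴿ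
++⇒∧ [] t = ∧-i top⊢ refl⊢
++⇒∧ (n<j ∷ e) t =
  mono (++⇒∧ e t) ⨾ᴿ ∧-i (mono ∧-e₁) (mono ∧-e₂ ⨾ᴿ ◇ᴿ-tail n<j t)

∧⇒++ : ∀ {n e t} → InW (suc n) e → Tail n t → ⟦ e ⟧ᴿ ∧ ⟦ t ⟧ᴿ ⊢ᴿ ⟦ e ++ t ⟧ᴿ
∧⇒++ [] t = ∧-e₂
∧⇒++ (n<j ∷ e) [] = ∧-e₁ ⨾ᴿ mono (∧-i refl⊢ top⊢ ⨾ᴿ ∧⇒++ e [])
∧⇒++ (n<j ∷ e) (at∷ f) = mix n<j ⨾ᴿ mono (∧⇒++ e (at∷ f))

data Compare (n : ℕ) (u v : Word) : Set where
  above : ⟦ u ⟧ᴿ ⊢ᴿ ◇ᴿ n ⟦ v ⟧ᴿ → Compare n u v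
  equiv : u ≡⊢ᴿ' v → Compare n u v
  below : ⟦ v ⟧ᴿ ⊢ᴿ ◇ᴿ n ⟦ u ⟧ᴿ → Compare n u v

-- A tail strictly above the other word decides at once. Otherwise each word proves the tail of the
-- other, and the upper parts decide.
compare-++ : ∀ {n e t e′ t′} → InW (suc n) e → Tail n t → InW (suc n) e′ → Tail n t′ →
  (⟦ t ⟧ᴿ ⊢ᴿ ◇ᴿ n ⟦ e′ ++ t′ ⟧ᴿ) ⊎ (⟦ e′ ++ t′ ⟧ᴿ ⊢ᴿ ⟦ t ⟧ᴿ) →
  (⟦ t′ ⟧ᴿ ⊢ᴿ ◇ᴿ n ⟦ e ++ t ⟧ᴿ) ⊎ (⟦ e ++ t ⟧ᴿ ⊢ᴿ ⟦ t′ ⟧ᴿ) →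
  Compare (suc n) e e′ → Compare n (e ++ t) (e′ ++ t′)
compare-++ e t e′ t′ (inj₁ p) _ _ = above (++⇒∧ e t ⨾ᴿ ∧-e₂ ⨾ᴿ p)
compare-++ e t e′ t′ (inj₂ _) (inj₁ q) _ = below (++⇒∧ e′ t′ ⨾ᴿ ∧-e₂ ⨾ᴿ q)
compare-++ e t e′ t′ (inj₂ p) (inj₂ q) (above r) =
  -- The letter `suc n` in front of `e′` still belongs to an upper part, so joining it with `t′`
  -- yields a diamond over the whole second word.
  above (∧-i (++⇒∧ e t ⨾ᴿ ∧-e₁ ⨾ᴿ r) q ⨾ᴿ ∧⇒++ (≤-refl ∷ e′) t′ ⨾ᴿ down ≤-refl)
compare-++ e t e′ t′ (inj₂ p) (inj₂ q) (below r) =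
  below (∧-i (++⇒∧ e′ t′ ⨾ᴿ ∧-e₁ ⨾ᴿ r) p ⨾ᴿ ∧⇒++ (≤-refl ∷ e) t ⨾ᴿ down ≤-refl)
compare-++ e t e′ t′ (inj₂ p) (inj₂ q) (equiv (r , s)) =
  equiv (∧-i (++⇒∧ e t ⨾ᴿ ∧-e₁ ⨾ᴿ r) q ⨾ᴿ ∧⇒++ e′ t′ ,
         ∧-i (++⇒∧ e′ t′ ⨾ᴿ ∧-e₁ ⨾ᴿ s) p ⨾ᴿ ∧⇒++ e t)

◇ᴿ-≤ : ∀ {m n A} → m ≤ n → ◇ᴿ n A ⊢ᴿ ◇ᴿ m A
◇ᴿ-≤ m≤n with m≤n⇒m<n∨m≡n m≤n
... | inj₁ m<n = down m<n
... | inj₂ refl = refl⊢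

compare-[] : ∀ {n v} → InW n v → Compare n [] v
compare-[] [] = equiv (refl⊢ , refl⊢)
compare-[] (n≤j ∷ _) = below (◇ᴿ-≤ n≤j ⨾ᴿ mono top⊢)

Compare-sym : ∀ {n u v} → Compare n u v → Compare n v u
Compare-sym (above p) = below p
Compare-sym (equiv p) = equiv (swap p)
Compare-sym (below p) = above p

compare : ∀ {n u v} → View n u → View n v → Compare n u v
compareTail : ∀ {n t v} → Tail n t → View n v →
              (⟦ t ⟧ᴿ ⊢ᴿ ◇ᴿ n ⟦ v ⟧ᴿ) ⊎ (⟦ v ⟧ᴿ ⊢ᴿ ⟦ t ⟧ᴿ)

compare empty v = compare-[] (view⇒InW v)
compare u empty = Compare-sym (compare-[] (view⇒InW u))
compare (e ⧺ t) (e′ ⧺ t′) =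
  compare-++ (view⇒InW e) t (view⇒InW e′) t′
    (compareTail t (e′ ⧺ t′)) (compareTail t′ (e ⧺ t)) (compare e e′)

compareTail [] v = inj₂ top⊢
compareTail (at∷ f) v with compare f v
... | above p = inj₁ (mono p ⨾ᴿ trans4)
... | equiv (p , _) = inj₁ (mono p)
... | below p = inj₂ p

compareTails : ∀ {n t t′} → Tail n t → Tail n t′ →
               (⟦ t ⟧ᴿ ⊢ᴿ ⟦ t′ ⟧ᴿ) ⊎ (⟦ t′ ⟧ᴿ ⊢ᴿ ⟦ t ⟧ᴿ)
compareTails t [] = inj₁ top⊢
compareTails [] (at∷ f′) = inj₂ top⊢
compareTails (at∷ f) (at∷ f′) with compareTail (at∷ f) f′
... | inj₁ p = inj₁ p
... | inj₂ p = inj₂ (mono p ⨾ᴿ trans4)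

-- The upper parts are met one level higher; the tails are comparable, so the stronger one serves
-- for both.
meetView : ∀ {n u v} → View n u → View n v →
           Σ[ w ∈ Word ] View n w × (⟦ w ⟧ᴿ ≡⊢ᴿ (⟦ u ⟧ᴿ ∧ ⟦ v ⟧ᴿ))
meetView empty v = _ , v , ∧-i top⊢ refl⊢ , ∧-e₂
meetView (e ⧺ t) empty = _ , (e ⧺ t) , ∧-i refl⊢ top⊢ , ∧-e₁
meetView (e ⧺ t) (e′ ⧺ t′) with meetView e e′ | compareTails t t′
... | w , wv , p , q | inj₁ r = _ , (wv ⧺ t) ,
  ++⇒∧ (view⇒InW wv) t ⨾ᴿ
    ∧-i (∧-i (∧-e₁ ⨾ᴿ p ⨾ᴿ ∧-e₁) ∧-e₂ ⨾ᴿ ∧⇒++ (view⇒InW e) t)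
        (∧-i (∧-e₁ ⨾ᴿ p ⨾ᴿ ∧-e₂) (∧-e₂ ⨾ᴿ r) ⨾ᴿ ∧⇒++ (view⇒InW e′) t′) ,
  ∧-i (∧-i (∧-e₁ ⨾ᴿ ++⇒∧ (view⇒InW e) t ⨾ᴿ ∧-e₁) (∧-e₂ ⨾ᴿ ++⇒∧ (view⇒InW e′) t′ ⨾ᴿ ∧-e₁) ⨾ᴿ q)
      (∧-e₁ ⨾ᴿ ++⇒∧ (view⇒InW e) t ⨾ᴿ ∧-e₂)
    ⨾ᴿ ∧⇒++ (view⇒InW wv) t
... | w , wv , p , q | inj₂ r = _ , (wv ⧺ t′) ,
  ++⇒∧ (view⇒InW wv) t′ ⨾ᴿ
    ∧-i (∧-i (∧-e₁ ⨾ᴿ p ⨾ᴿ ∧-e₁) (∧-e₂ ⨾ᴿ r) ⨾ᴿ ∧⇒++ (view⇒InW e) t)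
        (∧-i (∧-e₁ ⨾ᴿ p ⨾ᴿ ∧-e₂) ∧-e₂ ⨾ᴿ ∧⇒++ (view⇒InW e′) t′) ,
  ∧-i (∧-i (∧-e₁ ⨾ᴿ ++⇒∧ (view⇒InW e) t ⨾ᴿ ∧-e₁) (∧-e₂ ⨾ᴿ ++⇒∧ (view⇒InW e′) t′ ⨾ᴿ ∧-e₁) ⨾ᴿ q)
      (∧-e₂ ⨾ᴿ ++⇒∧ (view⇒InW e′) t′ ⨾ᴿ ∧-e₂)
    ⨾ᴿ ∧⇒++ (view⇒InW wv) t′

-- Transfer from RC to RC^∇

ι : RFm → Fm
ι (var x) = var x
ι top = top
ι (A ∧ B) = ι A ∧ ι B
ι (◇ᴿ n A) = ◇ n (ι A)

ι-sound : ∀ {A B} → A ⊢ᴿ B → ι A ⊢ ι B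
ι-sound refl⊢ = refl⊢
ι-sound top⊢ = top⊢
ι-sound ∧-e₁ = ∧-e₁
ι-sound ∧-e₂ = ∧-e₂
ι-sound (cut p q) = cut (ι-sound p) (ι-sound q)
ι-sound (∧-i p q) = ∧-i (ι-sound p) (ι-sound q)
ι-sound (mono p) = mono (ι-sound p)
ι-sound trans4 = trans4
ι-sound (down m<n) = down m<n
ι-sound (mix m<n) = mix m<n

ι-word : ∀ w → ι ⟦ w ⟧ᴿ ≡ ⟦ w ⟧
ι-word [] = refl
ι-word (j ∷ w) = cong (◇ j) (ι-word w)

ι-words : ∀ {u v} → ⟦ u ⟧ᴿ ⊢ᴿ ⟦ v ⟧ᴿ → ⟦ u ⟧ ⊢ ⟦ v ⟧
ι-words {u} {v} p = subst₂ _⊢_ (ι-word u) (ι-word v) (ι-sound p)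

++⊢ˡ : ∀ {n e t} → View (suc n) e → Tail n t → ⟦ e ++ t ⟧ ⊢ ⟦ e ⟧
++⊢ˡ e t = ι-words (++⇒∧ (view⇒InW e) t ⨾ᴿ ∧-e₁)

++⊢ʳ : ∀ {n e t} → View (suc n) e → Tail n t → ⟦ e ++ t ⟧ ⊢ ⟦ t ⟧
++⊢ʳ e t = ι-words (++⇒∧ (view⇒InW e) t ⨾ᴿ ∧-e₂)

∧⊢++ : ∀ {n e t} → InW (suc n) e → Tail n t → ⟦ e ⟧ ∧ ⟦ t ⟧ ⊢ ⟦ e ++ t ⟧
∧⊢++ {e = e} {t} p q =
  subst₂ _⊢_ (cong₂ _∧_ (ι-word e) (ι-word t)) (ι-word (e ++ t)) (ι-sound (∧⇒++ p q))

meetWord : ∀ {n u v} → InW n u → InW n v →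
           Σ[ w ∈ Word ] InW n w × ((⟦ u ⟧ ∧ ⟦ v ⟧) ≡⊢ ⟦ w ⟧)
meetWord {u = u} {v} p q with meetView (view p) (view q)
... | w , wv , r , s = w , view⇒InW wv ,
  subst₂ _⊢_ eq (ι-word w) (ι-sound s) , subst₂ _⊢_ (ι-word w) eq (ι-sound r)
  where
  eq : ι (⟦ u ⟧ᴿ ∧ ⟦ v ⟧ᴿ) ≡ ⟦ u ⟧ ∧ ⟦ v ⟧
  eq = cong₂ _∧_ (ι-word u) (ι-word v)

-- Existence of fat normal forms

≡⊢-trans : ∀ {A B C} → A ≡⊢ B → B ≡⊢ C → A ≡⊢ C
≡⊢-trans (p , q) (r , s) = p ⨾ r , s ⨾ q

∧-mono : ∀ {A B C D} → A ⊢ C → B ⊢ D → A ∧ B ⊢ C ∧ D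
∧-mono p q = ∧-i (∧-e₁ ⨾ p) (∧-e₂ ⨾ q)

∧-cong : ∀ {A B C D} → A ≡⊢ C → B ≡⊢ D → (A ∧ B) ≡⊢ (C ∧ D)
∧-cong (p , q) (r , s) = ∧-mono p r , ∧-mono q s

md-cong : ∀ {a n A B} → A ≡⊢ B → md a n A ≡⊢ md a n B
md-cong (p , q) = mono p , mono q

∇∇≤ : ∀ {m n A} → n ≤ m → ∇ m (∇ n A) ⊢ ∇ n A
∇∇≤ n≤m with m≤n⇒m<n∨m≡n n≤m
... | inj₁ n<m = down n<m ⨾ trans4
... | inj₂ refl = trans4

∇-∧ : ∀ {m n A B} → n < m → ∇ m (∇ n A ∧ B) ≡⊢ (∇ n A ∧ ∇ m B)
∇-∧ n<m =
  ∧-i (mono ∧-e₁ ⨾ ∇∇≤ (<⇒≤ n<m)) (mono ∧-e₂) ,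
  ∧-i ∧-e₂ ∧-e₁ ⨾ mix n<m ⨾ mono (∧-i ∧-e₂ ∧-e₁)

-- `∇ m` can be drawn out over the whole conjunction, lowered to `∇ n` and merged with the outer
-- one.
∇-∧-∇ : ∀ {m n A B} → n < m → ∇ n (∇ n A ∧ ∇ m B) ⊢ ∇ n (∇ n A ∧ B)
∇-∧-∇ n<m = mono (proj₂ (∇-∧ n<m) ⨾ down n<m) ⨾ trans4

-- The sequent ◇_m B ∧ ∇_n A ⊢ ◇_m (∇_n A ∧ B) fails in general: under ◇_m the
-- conjunct ∇_n A has the strength of ◇_n A.
◇-∧-∇ : ∀ {m n A B} → n < m → ◇ m (∇ n A ∧ B) ≡⊢ (◇ m B ∧ ◇ n A)
◇-∧-∇ n<m =
  ∧-i (mono ∧-e₂) (mono ∧-e₁ ⨾ down n<m ⨾ ◇∇◇ ≤-refl) ,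
  mix n<m ⨾ mono (∧-i (∧-e₂ ⨾ ◇∇) ∧-e₁)

∇-tail : ∀ {n t} → Tail n t → ∇ n ⟦ t ⟧ ⊢ ⟦ t ⟧
∇-tail [] = top⊢
∇-tail (at∷ _) = ∇◇◇ ≤-refl

absorb : ∀ {n w v} → ⟦ w ⟧ ⊢ ∇ (suc n) ⟦ v ⟧ → ∇ n ⟦ w ⟧ ⊢ ∇ n (∇ n ⟦ w ⟧ ∧ ⟦ v ⟧)
absorb p = mono (∧-i refl∇ p ⨾ proj₂ (∇-∧ ≤-refl) ⨾ down ≤-refl) ⨾ trans4

-- The upper part `e` of `w` is compared with `v`. If `e` is above or equivalent to `v`, then `w`
-- already suffices; if below, `v` replaces `e`, and the tail survives because `∇ n` of a tail
-- implies the tail.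
fatten : ∀ {n w v} → View n w → View (suc n) v →
         Σ[ w′ ∈ Word ] InW n w′ × (∇ n ⟦ w′ ⟧ ≡⊢ ∇ n (∇ n ⟦ w ⟧ ∧ ⟦ v ⟧))
fatten {v = v} empty vv =
  v , InW-pred (view⇒InW vv) , mono (∧-i (top⊢ ⨾ refl∇) refl⊢) , mono ∧-e₂
fatten {v = v} (_⧺_ {e} {t} ev tv) vv with compare ev vv
... | above p = e ++ t , view⇒InW (ev ⧺ tv) ,
  absorb (++⊢ˡ ev tv ⨾ ι-words {v = _ ∷ v} p ⨾ ◇∇) , mono ∧-e₁ ⨾ trans4
... | equiv (p , _) = e ++ t , view⇒InW (ev ⧺ tv) ,
  absorb (++⊢ˡ ev tv ⨾ ι-words p ⨾ refl∇) , mono ∧-e₁ ⨾ trans4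
... | below p = v ++ t , view⇒InW (vv ⧺ tv) ,
  mono (∧-i (∧-i (++⊢ˡ vv tv ⨾ ι-words {v = _ ∷ e} p) (++⊢ʳ vv tv)
              ⨾ ∧⊢++ (≤-refl ∷ view⇒InW ev) tv ⨾ ◇∇ ⨾ down ≤-refl)
            (++⊢ˡ vv tv)) ,
  mono (∧-i ∧-e₂ (∧-e₁ ⨾ mono (++⊢ʳ ev tv) ⨾ ∇-tail tv) ⨾ ∧⊢++ (view⇒InW vv) tv)

-- The empty list stands for the normal form `top`, so that both shapes of normal form are handled
-- by one recursion on lists.
⋀ : ℕ → List Word → Fm
⋀ n [] = top
⋀ n (w ∷ ws) = conj n w ws

Fat : ℕ → List Word → Set
Fat n [] = Unit
Fat n (w ∷ ws) = FatCond n w ws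

⋀-∷ : ∀ {n} w ws → ⋀ n (w ∷ ws) ≡⊢ (∇ n ⟦ w ⟧ ∧ ⋀ (suc n) ws)
⋀-∷ w [] = ∧-i refl⊢ top⊢ , ∧-e₁
⋀-∷ w (v ∷ vs) = refl⊢ , refl⊢

fat-tail : ∀ {n w} ws → Fat n (w ∷ ws) → Fat (suc n) ws
fat-tail [] _ = _
fat-tail (v ∷ vs) (_ , _ , p) = p

fat-word : ∀ {n w} ws → Fat n (w ∷ ws) → InW n w
fat-word [] (p , _) = p
fat-word (v ∷ vs) (p , _) = p

fat-head : ∀ {n w} ws → Fat n (w ∷ ws) → ∇ n (⋀ n (w ∷ ws)) ≡⊢ ∇ n ⟦ w ⟧
fat-head [] (_ , _ , p) = trans4 , p
fat-head (v ∷ vs) (_ , p , _) = mono ∧-e₁ ⨾ trans4 , p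

-- Closure of normal forms under the connectives

NF : ℕ → Fm → Set
NF n A = Σ[ ws ∈ List Word ] Fat n ws × (A ≡⊢ ⋀ n ws)

NF-resp : ∀ {n A B} → A ≡⊢ B → NF n B → NF n A
NF-resp p (ws , f , q) = ws , f , ≡⊢-trans p q

-- Fattening by the head `v` alone is enough: inside `∇ n`, the rest of the normal form can be
-- traded for `v` by its own fatness.
nf-∷ : ∀ {n w A} → InW n w → NF (suc n) A → NF n (∇ n ⟦ w ⟧ ∧ A)
-- The last word of a normal form must be nonempty, so this trivial conjunct is dropped.
nf-∷ {w = []} _ ([] , _ , _ , p) = [] , _ , top⊢ , ∧-i refl∇ p
nf-∷ {w = j ∷ w} q ([] , _ , _ , p) =
  (j ∷ w) ∷ [] , (q , (λ ()) , refl∇) , ∧-e₁ , ∧-i refl⊢ (top⊢ ⨾ p)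
nf-∷ {n} {w} {A} q (v ∷ vs , f , p) with fatten (view q) (view (fat-word vs f))
... | w′ , q′ , to , from =
  w′ ∷ v ∷ vs ,
  (q′ , strengthen ⨾ mono (∧-i (refl∇ ⨾ weaken) ∧-e₂) , f) ,
  ≡⊢-trans (∧-cong (refl⊢ , refl⊢) p) (∧-i (refl∇ ⨾ weaken) ∧-e₂ , ∧-mono strip refl⊢)
  where
  Y : Fm
  Y = ⋀ (suc n) (v ∷ vs)

  strengthen : ∇ n ⟦ w′ ⟧ ⊢ ∇ n (∇ n ⟦ w ⟧ ∧ Y)
  strengthen = to ⨾ mono (∧-mono refl⊢ (refl∇ ⨾ proj₂ (fat-head vs f))) ⨾ ∇-∧-∇ ≤-refl

  weaken : ∇ n (∇ n ⟦ w ⟧ ∧ Y) ⊢ ∇ n ⟦ w′ ⟧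
  weaken = mono (∧-mono refl⊢ (refl∇ ⨾ proj₁ (fat-head vs f))) ⨾ ∇-∧-∇ ≤-refl ⨾ from

  strip : ∇ n ⟦ w′ ⟧ ⊢ ∇ n ⟦ w ⟧
  strip = to ⨾ mono ∧-e₁ ⨾ trans4

-- Putting `∇ n` on the word may lose the upper part `e`, but not the tail; conjoining `e`,
-- normalized one level higher, restores it.
nf-word : ∀ {n w} → View n w → NF n ⟦ w ⟧
nf-word empty = [] , _ , refl⊢ , refl⊢
nf-word (e ⧺ t) =
  NF-resp
    (∧-i refl∇ (++⊢ˡ e t) ,
     ∧-i ∧-e₂ (∧-e₁ ⨾ mono (++⊢ʳ e t) ⨾ ∇-tail t) ⨾ ∧⊢++ (view⇒InW e) t)
    (nf-∷ (view⇒InW (e ⧺ t)) (nf-word e))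

∇-linear : ∀ {n u v} → InW n u → InW n v → (∇ n ⟦ u ⟧ ⊢ ∇ n ⟦ v ⟧) ⊎ (∇ n ⟦ v ⟧ ⊢ ∇ n ⟦ u ⟧)
∇-linear {u = u} {v} p q with compare (view p) (view q)
... | above r = inj₁ (mono (ι-words {v = _ ∷ v} r ⨾ ◇∇) ⨾ trans4)
... | equiv (r , _) = inj₁ (mono (ι-words r))
... | below r = inj₂ (mono (ι-words {v = _ ∷ u} r ⨾ ◇∇) ⨾ trans4)

nf-⋀-∧-⋀ : ∀ {n} ws vs → Fat n ws → Fat n vs → NF n (⋀ n ws ∧ ⋀ n vs)
nf-⋀-∧-⋀ [] vs _ g = vs , g , ∧-e₂ , ∧-i top⊢ refl⊢
nf-⋀-∧-⋀ (w ∷ ws) [] f _ = w ∷ ws , f , ∧-e₁ , ∧-i refl⊢ top⊢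
nf-⋀-∧-⋀ (w ∷ ws) (v ∷ vs) f g
  with nf-⋀-∧-⋀ ws vs (fat-tail ws f) (fat-tail vs g) | ∇-linear (fat-word ws f) (fat-word vs g)
... | r | inj₁ p =
  NF-resp
    (≡⊢-trans (∧-cong (⋀-∷ w ws) (⋀-∷ v vs))
      (∧-i (∧-e₁ ⨾ ∧-e₁) (∧-mono ∧-e₂ ∧-e₂) ,
       ∧-i (∧-mono refl⊢ ∧-e₁) (∧-mono p ∧-e₂)))
    (nf-∷ (fat-word ws f) r)
... | r | inj₂ p =
  NF-resp
    (≡⊢-trans (∧-cong (⋀-∷ w ws) (⋀-∷ v vs))
      (∧-i (∧-e₂ ⨾ ∧-e₁) (∧-mono ∧-e₂ ∧-e₂) ,
       ∧-i (∧-mono p ∧-e₁) (∧-mono refl⊢ ∧-e₂)))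
    (nf-∷ (fat-word vs g) r)

nf-∧ : ∀ {n A B} → NF n A → NF n B → NF n (A ∧ B)
nf-∧ (ws , f , p) (vs , g , q) = NF-resp (∧-cong p q) (nf-⋀-∧-⋀ ws vs f g)

-- `∇ m` passes over the conjuncts of index below `m`; from index `m` on, fatness collapses the rest
-- to its head.
nf-∇⋀ : ∀ k {n m} → k + n ≡ m → ∀ ws → Fat n ws → NF n (∇ m (⋀ n ws))
nf-∇⋀ _ _ [] _ = [] , _ , top⊢ , refl∇
nf-∇⋀ zero refl (w ∷ ws) f =
  NF-resp (≡⊢-trans (fat-head ws f) (∧-i refl⊢ top⊢ , ∧-e₁))
    (nf-∷ (fat-word ws f) ([] , _ , refl⊢ , refl⊢))
nf-∇⋀ (suc k) {n} refl (w ∷ ws) f =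
  NF-resp (≡⊢-trans (md-cong (⋀-∷ w ws)) (∇-∧ (subst (suc n ≤_) (+-suc k n) (m≤n+m (suc n) k))))
    (nf-∷ (fat-word ws f) (nf-∇⋀ k (+-suc k n) ws (fat-tail ws f)))

-- Below index `m` each `∇ i` turns into `◇ i`, and from `m` on only the head counts. The resulting
-- words have a conjunction that is again a word.
◇⋀-word : ∀ k {n m} → k + n ≡ m → ∀ ws → Fat n ws →
          Σ[ u ∈ Word ] InW n u × (◇ m (⋀ n ws) ≡⊢ ⟦ u ⟧)
◇⋀-word k {n} refl [] _ = (k + n) ∷ [] , m≤n+m n k ∷ [] , refl⊢ , refl⊢
◇⋀-word zero {n} refl (w ∷ ws) f =
  n ∷ w , ≤-refl ∷ fat-word ws f ,
  mono (refl∇ ⨾ proj₁ (fat-head ws f)) ⨾ ◇∇◇ ≤-refl ,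
  mono (refl∇ ⨾ proj₂ (fat-head ws f)) ⨾ ◇∇◇ ≤-refl
◇⋀-word (suc k) {n} refl (w ∷ ws) f with ◇⋀-word k (+-suc k n) ws (fat-tail ws f)
... | u , p , q with meetWord (InW-pred p) (≤-refl ∷ fat-word ws f)
...   | u′ , p′ , q′ = u′ , p′ ,
  ≡⊢-trans (md-cong (⋀-∷ w ws))
    (≡⊢-trans (◇-∧-∇ (subst (suc n ≤_) (+-suc k n) (m≤n+m (suc n) k)))
      (≡⊢-trans (∧-cong q (refl⊢ , refl⊢)) q′))

nf : ∀ {n A} → InF n A → NF n A
nf top = [] , _ , refl⊢ , refl⊢
nf (A ∧ B) = nf-∧ (nf A) (nf B)
nf (md {nab} n≤i A) with nf A
... | ws , f , p = NF-resp (md-cong p) (nf-∇⋀ _ (m∸n+n≡m n≤i) ws f)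
nf (md {dia} n≤i A) with nf A
... | ws , f , p with ◇⋀-word _ (m∸n+n≡m n≤i) ws f
...   | u , q , r = NF-resp (≡⊢-trans (md-cong p) r) (nf-word (view q))

-- The ordinal model and irreflexivity

infixr 5 ω^_+_
infix 4 _≺_ _∣_ _⊨_

-- Cantor-style notations, compared lexicographically.  The exponents need not
-- decrease: only linearity of the order is used, never well-foundedness.
data Ord : Set where
  𝟘     : Ord
  ω^_+_ : Ord → Ord → Ord

data _≺_ : Ord → Ord → Set where
  𝟘≺    : ∀ {a b} → 𝟘 ≺ ω^ a + b
  head≺ : ∀ {a a′ b b′} → a ≺ a′ → ω^ a + b ≺ ω^ a′ + b′
  tail≺ : ∀ {a b b′} → b ≺ b′ → ω^ a + b ≺ ω^ a + b′

≺-trans : Transitive _≺_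
≺-trans 𝟘≺ (head≺ _) = 𝟘≺
≺-trans 𝟘≺ (tail≺ _) = 𝟘≺
≺-trans (head≺ p) (head≺ q) = head≺ (≺-trans p q)
≺-trans (head≺ p) (tail≺ _) = head≺ p
≺-trans (tail≺ _) (head≺ q) = head≺ q
≺-trans (tail≺ p) (tail≺ q) = tail≺ (≺-trans p q)

≺-irrefl : ∀ {a} → ¬ (a ≺ a)
≺-irrefl (head≺ p) = ≺-irrefl p
≺-irrefl (tail≺ p) = ≺-irrefl p

≺-cmp : Trichotomous _≡_ _≺_
≺-cmp 𝟘 𝟘 = tri≈ (λ ()) refl (λ ())
≺-cmp 𝟘 (ω^ _ + _) = tri< 𝟘≺ (λ ()) (λ ())
≺-cmp (ω^ _ + _) 𝟘 = tri> (λ ()) (λ ()) 𝟘≺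
≺-cmp (ω^ a + b) (ω^ a′ + b′) with ≺-cmp a a′
... | tri< p _ _ = tri< (head≺ p) (λ { refl → ≺-irrefl p }) (λ q → ≺-irrefl (≺-trans (head≺ p) q))
... | tri> _ _ p = tri> (λ q → ≺-irrefl (≺-trans (head≺ p) q)) (λ { refl → ≺-irrefl p }) (head≺ p)
... | tri≈ _ refl _ with ≺-cmp b b′
...   | tri< q _ _ = tri< (tail≺ q) (λ { refl → ≺-irrefl q }) (λ r → ≺-irrefl (≺-trans (tail≺ q) r))
...   | tri≈ _ refl _ = tri≈ ≺-irrefl refl ≺-irrefl
...   | tri> _ _ q = tri> (λ r → ≺-irrefl (≺-trans (tail≺ q) r)) (λ { refl → ≺-irrefl q }) (tail≺ q)

≺-strictTotalOrder : StrictTotalOrder _ _ _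
≺-strictTotalOrder = record
  { isStrictTotalOrder = isStrictTotalOrderᶜ record
      { isEquivalence = isEquivalence ; trans = ≺-trans ; compare = ≺-cmp } }

open DecTotalOrder (StrictTotalOrderProperties.decTotalOrder ≺-strictTotalOrder)
  using (totalOrder) renaming (_≤_ to _≼_; trans to ≼-trans)
open Max totalOrder using (_⊔_; ⊔-sel; ⊔-lub; x≤x⊔y; x≤y⊔x)

≼-refl : ∀ {a} → a ≼ a
≼-refl = inj₂ refl

≺-≼-trans : ∀ {a b c} → a ≺ b → b ≼ c → a ≺ c
≺-≼-trans p (inj₁ q) = ≺-trans p q
≺-≼-trans p (inj₂ refl) = p

≼-≺-trans : ∀ {a b c} → a ≼ b → b ≺ c → a ≺ c
≼-≺-trans (inj₁ p) q = ≺-trans p q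
≼-≺-trans (inj₂ refl) q = q

≼∧≢⇒≺ : ∀ {a b} → a ≼ b → a ≢ b → a ≺ b
≼∧≢⇒≺ (inj₁ p) _ = p
≼∧≢⇒≺ (inj₂ e) a≢b = ⊥-elim (a≢b e)

𝟘≼ : ∀ a → 𝟘 ≼ a
𝟘≼ 𝟘 = ≼-refl
𝟘≼ (ω^ _ + _) = inj₁ 𝟘≺

tail≼ : ∀ {a b b′} → b ≼ b′ → ω^ a + b ≼ ω^ a + b′
tail≼ (inj₁ p) = inj₁ (tail≺ p)
tail≼ (inj₂ refl) = ≼-refl

⊔-lub-≺ : ∀ {a b c} → a ≺ c → b ≺ c → a ⊔ b ≺ c
⊔-lub-≺ {a} {b} p q with ⊔-sel a b
... | inj₁ e = subst (_≺ _) (sym e) p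
... | inj₂ e = subst (_≺ _) (sym e) q

-- The sum a + 1, which is the immediate successor for `≺`.
one+ : Ord → Ord
one+ 𝟘 = ω^ 𝟘 + 𝟘
one+ (ω^ a + b) = ω^ a + one+ b

≺-one+ : ∀ a → a ≺ one+ a
≺-one+ 𝟘 = 𝟘≺
≺-one+ (ω^ a + b) = tail≺ (≺-one+ b)

one+-≼ : ∀ {a b} → a ≺ b → one+ a ≼ b
one+-≼ (𝟘≺ {𝟘} {b}) = tail≼ (𝟘≼ b)
one+-≼ (𝟘≺ {ω^ _ + _}) = inj₁ (head≺ 𝟘≺)
one+-≼ (head≺ p) = inj₁ (head≺ p)
one+-≼ (tail≺ p) = tail≼ (one+-≼ p)

-- e ∣ a says that a is a multiple of ω^ e.
data _∣_ (e : Ord) : Ord → Set where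
  ∣𝟘 : e ∣ 𝟘
  ∣+ : ∀ {a b} → e ≼ a → e ∣ b → e ∣ ω^ a + b

∣-weaken : ∀ {e e′ a} → e ≼ e′ → e′ ∣ a → e ∣ a
∣-weaken p ∣𝟘 = ∣𝟘
∣-weaken p (∣+ q r) = ∣+ (≼-trans p q) (∣-weaken p r)

-- The least multiple of ω^ e that is at least the given notation: from the first exponent below `e`
-- on, everything is rounded up to a single ω^ e.
up : Ord → Ord → Ord
up e 𝟘 = 𝟘
up e (ω^ a + b) with ≺-cmp a e
... | tri< _ _ _ = ω^ e + 𝟘
... | tri≈ _ _ _ = ω^ a + up e b
... | tri> _ _ _ = ω^ a + up e b

∣-up : ∀ e a → e ∣ up e a
∣-up e 𝟘 = ∣𝟘
∣-up e (ω^ a + b) with ≺-cmp a e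
... | tri< _ _ _ = ∣+ ≼-refl ∣𝟘
... | tri≈ _ p _ = ∣+ (inj₂ (sym p)) (∣-up e b)
... | tri> _ _ p = ∣+ (inj₁ p) (∣-up e b)

≼-up : ∀ e a → a ≼ up e a
≼-up e 𝟘 = ≼-refl
≼-up e (ω^ a + b) with ≺-cmp a e
... | tri< p _ _ = inj₁ (head≺ p)
... | tri≈ _ _ _ = tail≼ (≼-up e b)
... | tri> _ _ _ = tail≼ (≼-up e b)

up-least : ∀ {e} a {x} → a ≼ x → e ∣ x → up e a ≼ x
up-least 𝟘 _ _ = 𝟘≼ _
up-least {e} (ω^ a + b) p q with ≺-cmp a e
up-least (ω^ a + b) (inj₁ (head≺ _)) (∣+ (inj₁ q) _) | tri< _ _ _ = inj₁ (head≺ q)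
up-least (ω^ a + b) (inj₁ (head≺ _)) (∣+ {b = b′} (inj₂ refl) _) | tri< _ _ _ = tail≼ (𝟘≼ b′)
up-least (ω^ a + b) (inj₁ (tail≺ _)) (∣+ q _) | tri< r _ _ = ⊥-elim (≺-irrefl (≺-≼-trans r q))
up-least (ω^ a + b) (inj₂ refl) (∣+ q _) | tri< r _ _ = ⊥-elim (≺-irrefl (≺-≼-trans r q))
up-least (ω^ a + b) (inj₁ (head≺ p)) _ | tri≈ _ _ _ = inj₁ (head≺ p)
up-least (ω^ a + b) (inj₁ (tail≺ p)) (∣+ _ q) | tri≈ _ _ _ = tail≼ (up-least b (inj₁ p) q)
up-least (ω^ a + b) (inj₂ refl) (∣+ _ q) | tri≈ _ _ _ = tail≼ (up-least b ≼-refl q)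
up-least (ω^ a + b) (inj₁ (head≺ p)) _ | tri> _ _ _ = inj₁ (head≺ p)
up-least (ω^ a + b) (inj₁ (tail≺ p)) (∣+ _ q) | tri> _ _ _ = tail≼ (up-least b (inj₁ p) q)
up-least (ω^ a + b) (inj₂ refl) (∣+ _ q) | tri> _ _ _ = tail≼ (up-least b ≼-refl q)

-- The last exponent after rounding is exactly `e`: the final exponent `𝟘` of a successor is either
-- below `e`, which triggers rounding, or equal to it.
∤-up-one+ : ∀ {e e′} a → e ≺ e′ → ¬ (e′ ∣ up e (one+ a))
∤-up-one+ {e} 𝟘 p d with ≺-cmp 𝟘 e | d
... | tri< _ _ _ | ∣+ q _ = ≺-irrefl (≺-≼-trans p q)
... | tri≈ _ _ _ | ∣+ q _ = ≺-irrefl (≺-≼-trans p (≼-trans q (𝟘≼ e)))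
... | tri> _ _ _ | ∣+ q _ = ≺-irrefl (≺-≼-trans p (≼-trans q (𝟘≼ e)))
∤-up-one+ {e} (ω^ a + b) p d with ≺-cmp a e | d
... | tri< _ _ _ | ∣+ q _ = ≺-irrefl (≺-≼-trans p q)
... | tri≈ _ _ _ | ∣+ _ q = ∤-up-one+ b p q
... | tri> _ _ _ | ∣+ _ q = ∤-up-one+ b p q

_⟨_⟩_ : Ord → Mod → Ord → Set
x ⟨ dia ⟩ y = x ≺ y
x ⟨ nab ⟩ y = x ≼ y

⟨⟩⇒≼ : ∀ a {x y} → x ⟨ a ⟩ y → x ≼ y
⟨⟩⇒≼ dia = inj₁
⟨⟩⇒≼ nab = id

⟨⟩-≼-trans : ∀ a {x y z} → x ⟨ a ⟩ y → y ≼ z → x ⟨ a ⟩ z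
⟨⟩-≼-trans dia = ≺-≼-trans
⟨⟩-≼-trans nab = ≼-trans

-- The entry needed by the witness for `mix`: at least `y`, and above `z` in the sense of the
-- modality. For `dia` strictness costs a successor.
join : Mod → Ord → Ord → Ord
join dia y z = one+ (y ⊔ z)
join nab y z = y ⊔ z

join-≼ˡ : ∀ a y z → y ≼ join a y z
join-≼ˡ dia y z = ≼-trans (x≤x⊔y y z) (inj₁ (≺-one+ _))
join-≼ˡ nab y z = x≤x⊔y y z

join-⟨⟩ʳ : ∀ a y z → z ⟨ a ⟩ join a y z
join-⟨⟩ʳ dia y z = ≼-≺-trans (x≤y⊔x y z) (≺-one+ _)
join-⟨⟩ʳ nab y z = x≤y⊔x y z

-- The strict case is the only place where multiples of ω^ e′ have to be limits of
-- multiples of ω^ e for e ≺ e′.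
up-join-⟨⟩ : ∀ a {y z x e e′} → y ⟨ a ⟩ x → z ⟨ a ⟩ x → e ⟨ a ⟩ e′ → e′ ∣ x →
             up e (join a y z) ⟨ a ⟩ x
up-join-⟨⟩ dia {y} {z} p q r d =
  ≼∧≢⇒≺ (up-least (one+ (y ⊔ z)) (one+-≼ (⊔-lub-≺ p q)) (∣-weaken (inj₁ r) d))
        (λ { refl → ∤-up-one+ (y ⊔ z) r d })
up-join-⟨⟩ nab {y} {z} p q r d = up-least (y ⊔ z) (⊔-lub p q) (∣-weaken r d)

-- Points of the model

Seq : Set
Seq = ℕ → Ord

Valid : Seq → Set
Valid x = ∀ i → x (suc i) ∣ x i

-- The entries below k are raised, from k - 1 down to 0, to the least values above b
-- that restore validity.
raise : ℕ → Seq → Seq → Seq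
raise zero b y = y
raise (suc k) b y zero = up (raise k (b ∘ suc) (y ∘ suc) 0) (b 0)
raise (suc k) b y (suc i) = raise k (b ∘ suc) (y ∘ suc) i

raise-valid : ∀ k {b y} → Valid y → Valid (raise k b y)
raise-valid zero v = v
raise-valid (suc k) {b} v zero = ∣-up _ (b 0)
raise-valid (suc k) v (suc i) = raise-valid k (v ∘ suc) i

≼-raise : ∀ k {b y i} → i < k → b i ≼ raise k b y i
≼-raise (suc k) {i = zero} _ = ≼-up _ _
≼-raise (suc k) {i = suc i} (s≤s p) = ≼-raise k p

≼-raise-base : ∀ k {b y} → (∀ i → y i ≼ b i) → ∀ i → y i ≼ raise k b y i
≼-raise-base zero p i = ≼-refl
≼-raise-base (suc k) p zero = ≼-trans (p 0) (≼-up _ _)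
≼-raise-base (suc k) p (suc i) = ≼-raise-base k (p ∘ suc) i

-- The bound at entry i + 1 compares the exponents used at entry i, and validity of `x` supplies the
-- divisibility. Since `k ≤ n`, entry `k`, the exponent for the topmost raised entry, is bounded by
-- assumption.
raise-⟨⟩ : ∀ a {k n b y x} → Valid x → k ≤ n →
           (∀ i → i < k → ∀ {e e′} → e ⟨ a ⟩ e′ → e′ ∣ x i → up e (b i) ⟨ a ⟩ x i) →
           (∀ i → i ≤ n → y i ⟨ a ⟩ x i) →
           ∀ i → i ≤ n → raise k b y i ⟨ a ⟩ x i
raise-⟨⟩ a {zero} v _ _ q i i≤n = q i i≤n
raise-⟨⟩ a {suc k} {suc n} v (s≤s k≤n) p q zero _ =
  p 0 (s≤s z≤n)
    (raise-⟨⟩ a (v ∘ suc) k≤n (λ i i<k → p (suc i) (s≤s i<k)) (λ i i≤n → q (suc i) (s≤s i≤n)) 0 z≤n)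
    (v 0)
raise-⟨⟩ a {suc k} {suc n} v (s≤s k≤n) p q (suc i) (s≤s i≤n) =
  raise-⟨⟩ a (v ∘ suc) k≤n (λ i i<k → p (suc i) (s≤s i<k)) (λ i i≤n → q (suc i) (s≤s i≤n)) i i≤n

-- Truth at points, persistence and soundness

_⊨_ : Seq → Fm → Set
x ⊨ var _ = Unit
x ⊨ top = Unit
x ⊨ A ∧ B = (x ⊨ A) × (x ⊨ B)
x ⊨ md a n A = Σ[ y ∈ Seq ] Valid y × (∀ i → i ≤ n → y i ⟨ a ⟩ x i) × (y ⊨ A)

persistent : ∀ A {x y} → (∀ i → x i ≼ y i) → x ⊨ A → y ⊨ A
persistent (var _) _ _ = _
persistent top _ _ = _
persistent (A ∧ B) p (q , r) = persistent A p q , persistent B p r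
persistent (md a n A) p (z , v , q , r) = z , v , (λ i i≤n → ⟨⟩-≼-trans a (q i i≤n) (p i)) , r

sound : ∀ {A B} → A ⊢ B → ∀ {x} → Valid x → x ⊨ A → x ⊨ B
sound refl⊢ _ p = p
sound top⊢ _ _ = _
sound ∧-e₁ _ = proj₁
sound ∧-e₂ _ = proj₂
sound (cut d e) v p = sound e v (sound d v p)
sound (∧-i d e) v p = sound d v p , sound e v p
sound (mono d) _ (y , v , q , p) = y , v , q , sound d v p
sound (trans4 {a}) _ (y , _ , q , z , v , r , p) =
  z , v , (λ i i≤n → ⟨⟩-≼-trans a (r i i≤n) (⟨⟩⇒≼ a (q i i≤n))) , p
sound (down m<n) _ (y , v , q , p) =
  y , v , (λ i i≤m → q i (≤-trans i≤m (<⇒≤ m<n))) , p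
sound (mix {a} {m} {n} {A} m<n) vx ((y , vy , q , p) , (z , vz , r , s)) =
  -- The witness is `y` with its entries up to `m` raised above those of `z`; it keeps `A` by
  -- persistence and sees `z`.
  u , raise-valid (suc m) vy ,
  raise-⟨⟩ a vx m<n
    (λ { i (s≤s i≤m) → up-join-⟨⟩ a (q i (≤-trans i≤m (<⇒≤ m<n))) (r i i≤m) }) q ,
  persistent A (≼-raise-base (suc m) (λ i → join-≼ˡ a (y i) (z i))) p ,
  z , vz , (λ i i≤m → ⟨⟩-≼-trans a (join-⟨⟩ʳ a (y i) (z i)) (≼-raise (suc m) (s≤s i≤m))) , s
  where
  u : Seq
  u = raise (suc m) (λ i → join a (y i) (z i)) y
sound refl∇ {x} v p = x , v , (λ _ _ → ≼-refl) , p
sound ◇∇ _ (y , v , q , p) = y , v , (λ i i≤n → inj₁ (q i i≤n)) , p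
sound (◇∇◇ m≤n) _ (y , _ , q , z , v , r , p) =
  z , v , (λ i i≤m → ≼-≺-trans (r i (≤-trans i≤m m≤n)) (q i i≤m)) , p
sound (∇◇◇ m≤n) _ (y , _ , q , z , v , r , p) =
  z , v , (λ i i≤m → ≺-≼-trans (r i i≤m) (q i (≤-trans i≤m m≤n))) , p

-- Entries up to `j` must strictly exceed those for `w`; the entries beyond `j` are unconstrained,
-- hence `𝟘`.
least : Word → Seq
least [] _ = 𝟘
least (j ∷ w) = raise (suc j) (one+ ∘ least w) (const 𝟘)

least-valid : ∀ w → Valid (least w)
least-valid [] _ = ∣𝟘
least-valid (j ∷ w) = raise-valid (suc j) (λ _ → ∣𝟘)

least-⊨ : ∀ w → least w ⊨ ⟦ w ⟧
least-⊨ [] = _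
least-⊨ (j ∷ w) =
  least w , least-valid w ,
  (λ i i≤j → ≺-≼-trans (≺-one+ _) (≼-raise (suc j) (s≤s i≤j))) , least-⊨ w

least-≼ : ∀ w {x} → Valid x → x ⊨ ⟦ w ⟧ → ∀ i → least w i ≼ x i
least-≼ [] _ _ i = 𝟘≼ _
least-≼ (j ∷ w) v (y , vy , q , p) i =
  -- The bound `suc j + i` covers the raised entries and the entry `i` in question.
  raise-⟨⟩ nab v (m≤m+n (suc j) i)
    (λ { l (s≤s l≤j) r d →
       up-least (one+ (least w l)) (one+-≼ (≼-≺-trans (least-≼ w vy p l) (q l l≤j))) (∣-weaken r d) })
    (λ _ _ → 𝟘≼ _) i (m≤n+m i (suc j))

⊬◇-self : ∀ n w → ¬ (⟦ w ⟧ ⊢ ◇ n ⟦ w ⟧)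
⊬◇-self n w d with sound d (least-valid w) (least-⊨ w)
... | y , v , q , p = ≺-irrefl (≼-≺-trans (least-≼ w v p n) (q n ≤-refl))

-- Uniqueness of fat normal forms

truncate : ∀ {P : Set} → Dec P → Fm → Fm
truncate (yes _) A = top
truncate (no _) A = A

peel : ℕ → Fm → Fm
peel k (var x) = var x
peel k top = top
peel k (A ∧ B) = peel k A ∧ peel k B
peel k (md a n A) = truncate (n ≤? k) (md a n (peel k A))

-- Peeling replaces a whole subformula by `top`. Except in `mix`, the outer modality on the right
-- has the smallest index in the axiom, so it disappears whenever another one does.
peel-sound : ∀ k {A B} → A ⊢ B → peel k A ⊢ peel k B
peel-sound k refl⊢ = refl⊢
peel-sound k top⊢ = top⊢
peel-sound k ∧-e₁ = ∧-e₁
peel-sound k ∧-e₂ = ∧-e₂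
peel-sound k (cut p q) = cut (peel-sound k p) (peel-sound k q)
peel-sound k (∧-i p q) = ∧-i (peel-sound k p) (peel-sound k q)
peel-sound k (mono {n = n} p) with n ≤? k
... | yes _ = top⊢
... | no _ = mono (peel-sound k p)
peel-sound k (trans4 {n = n}) with n ≤? k
... | yes _ = top⊢
... | no _ = trans4
peel-sound k (down {m = m} {n} m<n) with m ≤? k | n ≤? k
... | yes _ | _ = top⊢
... | no _ | no _ = down m<n
... | no m≰k | yes n≤k = ⊥-elim (m≰k (≤-trans (<⇒≤ m<n) n≤k))
peel-sound k (mix {m = m} {n} m<n) with n ≤? k | m ≤? k
... | yes _ | _ = top⊢
-- Only the conjunct of index `m` has been erased, which leaves `top` to be supplied under the
-- modality.
... | no _ | yes _ = ∧-e₁ ⨾ mono (∧-i refl⊢ top⊢)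
... | no _ | no _ = mix m<n
peel-sound k (refl∇ {n}) with n ≤? k
... | yes _ = top⊢
... | no _ = refl∇
peel-sound k (◇∇ {n}) with n ≤? k
... | yes _ = top⊢
... | no _ = ◇∇
peel-sound k (◇∇◇ {m} {n} m≤n) with m ≤? k | n ≤? k
... | yes _ | _ = top⊢
... | no _ | no _ = ◇∇◇ m≤n
... | no m≰k | yes n≤k = ⊥-elim (m≰k (≤-trans m≤n n≤k))
peel-sound k (∇◇◇ {m} {n} m≤n) with m ≤? k | n ≤? k
... | yes _ | _ = top⊢
... | no _ | no _ = ∇◇◇ m≤n
... | no m≰k | yes n≤k = ⊥-elim (m≰k (≤-trans m≤n n≤k))

peel-> : ∀ {k a n A} → k < n → peel k (md a n A) ≡ md a n (peel k A)
peel-> {k} {n = n} k<n with n ≤? k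
... | yes n≤k = ⊥-elim (<⇒≱ k<n n≤k)
... | no _ = refl

peel-word : ∀ {k w} → InW (suc k) w → peel k ⟦ w ⟧ ≡ ⟦ w ⟧
peel-word [] = refl
peel-word {w = j ∷ w} (k<j ∷ p) = trans (peel-> {A = ⟦ w ⟧} k<j) (cong (◇ j) (peel-word p))

peel-∇word : ∀ {k n w} → k < n → InW n w → peel k (∇ n ⟦ w ⟧) ≡ ∇ n ⟦ w ⟧
peel-∇word {n = n} {w} k<n p =
  trans (peel-> {A = ⟦ w ⟧} k<n) (cong (∇ n) (peel-word (All.map (<-≤-trans k<n) p)))

peel-⋀ : ∀ {k n} → k < n → ∀ ws → Fat n ws → peel k (⋀ n ws) ≡ ⋀ n ws
peel-⋀ k<n [] _ = refl
peel-⋀ k<n (w ∷ []) (p , _) = peel-∇word k<n p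
peel-⋀ k<n (w ∷ v ∷ vs) (p , _ , f) =
  cong₂ _∧_ (peel-∇word k<n p) (peel-⋀ (m<n⇒m<1+n k<n) (v ∷ vs) f)

-- Peeling at `n` turns the left head into `top` and fixes both tails, whose modalities all have
-- index above `n`.
⋀-tail-mono : ∀ {n} w ws v vs → Fat n (w ∷ ws) → Fat n (v ∷ vs) →
              ⋀ n (w ∷ ws) ⊢ ⋀ n (v ∷ vs) → ⋀ (suc n) ws ⊢ ⋀ (suc n) vs
⋀-tail-mono {n} w ws v vs f g p =
  ∧-i erased refl⊢ ⨾
  subst₂ (λ A B → peel n (∇ n ⟦ w ⟧) ∧ A ⊢ B)
    (peel-⋀ ≤-refl ws (fat-tail ws f)) (peel-⋀ ≤-refl vs (fat-tail vs g))
    (peel-sound n (proj₂ (⋀-∷ w ws) ⨾ p ⨾ proj₁ (⋀-∷ v vs) ⨾ ∧-e₂))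
  where
  erased : ∀ {A} → A ⊢ peel n (∇ n ⟦ w ⟧)
  erased with n ≤? n
  ... | yes _ = top⊢
  ... | no n≰n = ⊥-elim (n≰n ≤-refl)

∇-word-injective : ∀ {n w v} → InW n w → InW n v → ∇ n ⟦ w ⟧ ≡⊢ ∇ n ⟦ v ⟧ → w ≡⊢ᴿ' v
∇-word-injective {n} {w} {v} p q (r , s) with compare (view p) (view q)
... | above d = ⊥-elim (⊬◇-self n w (ι-words {v = n ∷ v} d ⨾ mono (refl∇ ⨾ s) ⨾ ◇∇◇ ≤-refl))
... | equiv e = e
... | below d = ⊥-elim (⊬◇-self n v (ι-words {v = n ∷ w} d ⨾ mono (refl∇ ⨾ r) ⨾ ◇∇◇ ≤-refl))

-- The last word begins with a diamond, so its conjunct would yield `◇ n top` from `top`, against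
-- irreflexivity for the empty word.
⊬⋀ : ∀ {n} w ws → Fat n (w ∷ ws) → ¬ (top ⊢ ⋀ n (w ∷ ws))
⊬⋀ [] [] (_ , w≢[] , _) _ = w≢[] refl
⊬⋀ {n} (j ∷ w) [] (n≤j ∷ _ , _) p =
  ⊬◇-self n [] (p ⨾ mono (ι-words {j ∷ w} {n ∷ w} (◇ᴿ-≤ n≤j)) ⨾ ∇◇◇ ≤-refl ⨾ mono top⊢)
⊬⋀ w (v ∷ vs) (_ , _ , f) p = ⊬⋀ v vs f (p ⨾ ∧-e₂)

⋀-injective : ∀ {n} ws vs → Fat n ws → Fat n vs → ⋀ n ws ≡⊢ ⋀ n vs → Pointwise _≡⊢ᴿ'_ ws vs
⋀-injective [] [] _ _ _ = []
⋀-injective [] (v ∷ vs) _ g (p , _) = ⊥-elim (⊬⋀ v vs g p)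
⋀-injective (w ∷ ws) [] f _ (_ , q) = ⊥-elim (⊬⋀ w ws f q)
⋀-injective (w ∷ ws) (v ∷ vs) f g (p , q) =
  ∇-word-injective (fat-word ws f) (fat-word vs g)
    (≡⊢-trans (swap (fat-head ws f)) (≡⊢-trans (md-cong (p , q)) (fat-head vs g)))
  ∷ ⋀-injective ws vs (fat-tail ws f) (fat-tail vs g)
      (⋀-tail-mono w ws v vs f g p , ⋀-tail-mono v vs w ws g f q)

theorem4 : (n : ℕ) →
    ((A : Fm) → InF n A → Σ[ B ∈ Fm ] (IsFNF n B × (A ≡⊢ B)))
    × ((A : Fm) → InF n A →
    (w : Word) (ws : List Word) (v : Word) (vs : List Word) →
    FatCond n w ws → FatCond n v vs →
    A ≡⊢ conj n w ws → A ≡⊢ conj n v vs →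
    (length ws ≡ length vs) × (w ≡⊢ᴿ' v) × Pointwise _≡⊢ᴿ'_ ws vs)
theorem4 n = existence , uniqueness
  where
  existence : (A : Fm) → InF n A → Σ[ B ∈ Fm ] (IsFNF n B × (A ≡⊢ B))
  existence A p with nf p
  ... | [] , _ , q = top , inj₁ refl , q
  ... | w ∷ ws , f , q = conj n w ws , inj₂ (w , ws , refl , f) , q

  uniqueness : (A : Fm) → InF n A →
    (w : Word) (ws : List Word) (v : Word) (vs : List Word) →
    FatCond n w ws → FatCond n v vs →
    A ≡⊢ conj n w ws → A ≡⊢ conj n v vs →
    (length ws ≡ length vs) × (w ≡⊢ᴿ' v) × Pointwise _≡⊢ᴿ'_ ws vs
  uniqueness A _ w ws v vs f g p q
    with ⋀-injective (w ∷ ws) (v ∷ vs) f g (≡⊢-trans (swap p) q)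
  ... | e ∷ es = Pointwise-length es , e , es
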